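{- Given a string $T$ of length $n$ and a string attractor $\Gamma$ of size $\gamma$ for $T$, one can build a straight-line program (SLP) for $T$ of size $\mathcal{O}(\gamma\log^2(n/\gamma))$.
   Context: A string attractor of $T$ is a set $\Gamma\subseteq\{1,\dots,n\}$ such that every substring $T[i..j]$ has an occurrence $T[i'..j']=T[i..j]$ with $p\in[i',j']$ for some $p\in\Gamma$. A straight-line program is a context-free grammar generating exactly one string, with rules of the forms $X\rightarrow AB$ ($A,B$ nonterminals) and $X\rightarrow a$ ($a$ terminal), acyclic, with a starting nonterminal whose expansion is $T$; its size is its number of rules. -}

module Defs where

open import Data.Nat using (ℕ; zero; suc; _+_; _*_; _∸_; _≤_; _<_; _/_)
open import Data.Nat.Logarithm using (⌊log₂_⌋)
open import Data.List using (List; []; _∷_; _++_; length; take; drop)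
open import Data.List.Membership.Propositional using (_∈_)
open import Data.List.Relation.Unary.All using (All)
open import Data.List.Relation.Unary.Unique.Propositional using (Unique)
open import Data.Product using (Σ; ∃; _×_)
open import Relation.Binary.PropositionalEquality using (_≡_)

-- Strings are lists over an alphabet A; positions are 0-based.
-- T[i..j] (inclusive, 0-based) :
substr : {A : Set} → List A → ℕ → ℕ → List A
substr T i j = take (suc j ∸ i) (drop i T)

IsAttractor : {A : Set} → List A → List ℕ → Set
IsAttractor T Γ =
  ∀ i j → i ≤ j → j < length T →
  Σ ℕ λ i' → Σ ℕ λ j' →
    i' ≤ j' × j' < length T × substr T i' j' ≡ substr T i j ×
    Σ ℕ λ p → p ∈ Γ × i' ≤ p × p ≤ j'

IsPositionSet : {A : Set} → List A → List ℕ → Set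
IsPositionSet T Γ = Unique Γ × All (_< length T) Γ

-- Straight-line programs. Nonterminals are numbered 0,1,…,s-1 (rule k defines
-- nonterminal k); a rule is either X → a or X → Y Z.  Acyclicity is imposed by
-- requiring Y, Z < X (any acyclic grammar can be topologically numbered this way).
data Rule (A : Set) : Set where
  term : A → Rule A
  pair : ℕ → ℕ → Rule A

SLP : Set → Set
SLP A = List (Rule A)

data _!_≡_ {B : Set} : List B → ℕ → B → Set where
  here  : ∀ {x xs} → (x ∷ xs) ! zero ≡ x
  there : ∀ {x y xs k} → xs ! k ≡ y → (x ∷ xs) ! suc k ≡ y

Acyclic : {A : Set} → SLP A → Set
Acyclic G = ∀ k l r → G ! k ≡ pair l r → l < k × r < k

data Expands {A : Set} (G : SLP A) : ℕ → List A → Set where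
  exp-term : ∀ {X a} → G ! X ≡ term a → Expands G X (a ∷ [])
  exp-pair : ∀ {X Y Z u v} → G ! X ≡ pair Y Z →
             Expands G Y u → Expands G Z v → Expands G X (u ++ v)

GeneratesSLP : {A : Set} → SLP A → List A → Set
GeneratesSLP G T = Acyclic G × Σ ℕ λ S → S < length G × Expands G S T

-- ⌊n/γ⌋ (γ = 0 never occurs in the theorem, since n ≥ 1 forces γ ≥ 1)
ratio : ℕ → ℕ → ℕ
ratio n zero    = n
ratio n (suc g) = n / suc g

-- γ · log²(n/γ), with the log term taken as 1 + ⌊log₂ ⌊n/γ⌋⌋ ≥ 1
bound : ℕ → ℕ → ℕ
bound n γ = γ * ((1 + ⌊log₂ ratio n γ ⌋) * (1 + ⌊log₂ ratio n γ ⌋))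

{-# OPTIONS --safe #-}

-- Every word is cut out of larger words already generated.  If a nonterminal
-- has a derivation tree of height h, any factor of its expansion can be generated
-- with at most 2h new rules and again height at most h.  Suppose every factor of T of
-- length at most m lies inside some generated word of height h.  For each attractor
-- position p, the window of length 4m around p splits into four pieces of length m,
-- so it is generated with O(h) new rules at height h + 4; by the attractor property,
-- every factor of length at most 2m lies inside such a window.  Iterating over
-- m = 2^k for k ≤ K = ⌊log₂ (n/γ)⌋ costs O(γ K²) rules, and T itself is then
-- a concatenation of at most 2γ pieces of length 2^K, at O(K) rules each.
module Submission where

open import Defs
open import Data.Nat using (ℕ; zero; suc; _+_; _*_; _∸_; _^_; _≤_; _<_; z≤n; s≤s; _/_; _%_; _⊓_)
open import Data.Nat.Properties
open import Data.Nat.DivMod using (m≡m%n+[m/n]*n; m%n<n)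
open import Data.Nat.Logarithm using (⌊log₂_⌋; ⌊log₂⌋-mono-≤; ⌊log₂[2^n]⌋≡n)
open import Data.Nat.Tactic.RingSolver using (solve-∀)
open import Data.List using (List; []; _∷_; _++_; _∷ʳ_; length; take; drop)
open import Data.List.Properties
  using (++-assoc; ++-identityʳ; ∷-injective; length-++; length-take; length-drop;
         take++drop≡id; drop-drop)
open import Data.List.Membership.Propositional using (_∈_)
open import Data.List.Relation.Unary.All using (All; []; _∷_)
import Data.List.Relation.Unary.All as All
open import Data.List.Relation.Unary.Any using (here; there)
open import Data.Product using (Σ; ∃; ∃₂; _×_; _,_)
open import Data.Sum using (_⊎_; inj₁; inj₂)
open import Relation.Binary using (DecidableEquality)
open import Relation.Binary.PropositionalEquality
  using (_≡_; refl; sym; trans; cong; cong₂; subst; module ≡-Reasoning)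

private
  variable
    A : Set
    c d h h′ k m : ℕ
    u v w x y : List A

-- Factors

Factor : List A → List A → Set
Factor w v = ∃₂ λ x y → v ≡ x ++ w ++ y

Factor-refl : Factor w w
Factor-refl {w = w} = [] , [] , sym (++-identityʳ w)

Factor-trans : Factor u v → Factor v w → Factor u w
Factor-trans {u = u} (x , y , refl) (x′ , y′ , refl) = x′ ++ x , y ++ y′ , (begin
  x′ ++ (x ++ u ++ y) ++ y′  ≡⟨ cong (x′ ++_) (++-assoc x (u ++ y) y′) ⟩
  x′ ++ x ++ (u ++ y) ++ y′  ≡⟨ cong (λ z → x′ ++ x ++ z) (++-assoc u y y′) ⟩
  x′ ++ x ++ u ++ y ++ y′    ≡⟨ ++-assoc x′ x _ ⟨
  (x′ ++ x) ++ u ++ y ++ y′  ∎)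
  where open ≡-Reasoning

take-Factor : ∀ k (u : List A) → Factor (take k u) u
take-Factor k u = [] , drop k u , sym (take++drop≡id k u)

drop-Factor : ∀ k (u : List A) → Factor (drop k u) u
drop-Factor k u = take k u , [] ,
  trans (sym (take++drop≡id k u)) (cong (take k u ++_) (sym (++-identityʳ _)))

-- Levi's lemma. With `u` the word of a left child and `x` the part before a cut, it tells which
-- child the cut falls in and where.
levi : ∀ (u : List A) {v} x {y} → u ++ v ≡ x ++ y →
  (∃ λ z → x ≡ u ++ z × v ≡ z ++ y) ⊎ (∃ λ z → u ≡ x ++ z × y ≡ z ++ v)
levi []      x       eq = inj₁ (x , refl , eq)
levi (a ∷ u) []      eq = inj₂ (a ∷ u , refl , sym eq)
levi (a ∷ u) (b ∷ x) eq with ∷-injective eq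
... | refl , eq′ with levi u x eq′
...   | inj₁ (z , p , q) = inj₁ (z , cong (a ∷_) p , q)
...   | inj₂ (z , p , q) = inj₂ (z , cong (a ∷_) p , q)

take-+ : ∀ k l (u : List A) → take (k + l) u ≡ take k u ++ take l (drop k u)
take-+ zero    l u       = refl
take-+ (suc k) l []      with l
... | zero  = refl
... | suc _ = refl
take-+ (suc k) l (a ∷ u) = cong (a ∷_) (take-+ k l u)

take-drop-++ : ∀ (x w y : List A) → take (length w) (drop (length x) (x ++ w ++ y)) ≡ w
take-drop-++ []      []      y = refl
take-drop-++ []      (a ∷ w) y = cong (a ∷_) (take-drop-++ [] w y)
take-drop-++ (_ ∷ x) w       y = take-drop-++ x w y

-- The outer length splits as `d + k + e`, where `d` is the offset from `a` to `i`. Either interval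
-- may overrun the end of `T`, since `take` and `drop` clip both alike.
window-Factor : ∀ (T : List A) {a i k l} → a ≤ i → i + k ≤ a + l →
  Factor (take k (drop i T)) (take l (drop a T))
window-Factor T {a} {i} {k} {l} a≤i i+k≤a+l with m≤n⇒∃[o]m+o≡n a≤i
... | d , refl with m≤n⇒∃[o]m+o≡n
                      (+-cancelˡ-≤ a (d + k) l (≤-trans (≤-reflexive (sym (+-assoc a d k))) i+k≤a+l))
... | e , refl = take d U , take e (drop (d + k) U) , (begin
  take (d + k + e) U                                         ≡⟨ cong (λ n → take n U) (+-assoc d k e) ⟩
  take (d + (k + e)) U                                       ≡⟨ take-+ d (k + e) U ⟩
  take d U ++ take (k + e) (drop d U)                        ≡⟨ cong (take d U ++_) (take-+ k e (drop d U)) ⟩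
  take d U ++ take k (drop d U) ++ take e (drop k (drop d U)) ≡⟨ cong₂ (λ s t → take d U ++ take k s ++ take e t) (drop-drop a d T) (drop-drop d k U) ⟩
  take d U ++ take k (drop (a + d) T) ++ take e (drop (d + k) U) ∎)
  where
  open ≡-Reasoning
  U = drop a T

length-take-≤ : ∀ k (u : List A) → length (take k u) ≤ k
length-take-≤ k u = ≤-trans (≤-reflexive (length-take k u)) (m⊓n≤m k (length u))

-- Extensions of grammars

!-++ˡ : ∀ {B : Set} {xs ys : List B} {k b} → xs ! k ≡ b → (xs ++ ys) ! k ≡ b
!-++ˡ here      = here
!-++ˡ (there p) = there (!-++ˡ p)

!-last : ∀ {B : Set} (xs : List B) {b} → (xs ∷ʳ b) ! length xs ≡ b
!-last []       = here
!-last (_ ∷ xs) = there (!-last xs)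

!-∷ʳ⁻ : ∀ {B : Set} (xs : List B) {k a b} → (xs ∷ʳ a) ! k ≡ b →
  xs ! k ≡ b ⊎ (k ≡ length xs × a ≡ b)
!-∷ʳ⁻ []       here      = inj₂ (refl , refl)
!-∷ʳ⁻ (_ ∷ xs) here      = inj₁ here
!-∷ʳ⁻ (_ ∷ xs) (there p) with !-∷ʳ⁻ xs p
... | inj₁ q          = inj₁ (there q)
... | inj₂ (refl , q) = inj₂ (refl , q)

!⇒< : ∀ {B : Set} {xs : List B} {k b} → xs ! k ≡ b → k < length xs
!⇒< here      = s≤s z≤n
!⇒< (there p) = s≤s (!⇒< p)

record Grammar (A : Set) : Set where
  constructor grammar
  field
    rules   : SLP A
    acyclic : Acyclic rules

open Grammar

size : Grammar A → ℕ
size G = length (rules G)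

infix 4 _≼_
_≼_ : Grammar A → Grammar A → Set
G ≼ G′ = ∀ {k r} → rules G ! k ≡ r → rules G′ ! k ≡ r

-- A graded monad: costs add under `_>>=_`, and as old rules keep their numbers, derivations found
-- earlier survive every extension.
record Within {A : Set} (c : ℕ) (G : Grammar A) (P : Grammar A → Set) : Set where
  constructor within
  field
    target  : Grammar A
    extends : G ≼ target
    size≤   : size target ≤ c + size G
    holds   : P target

private
  variable
    G G′ : Grammar A
    P Q : Grammar A → Set

pure : P G → Within c G P
pure {G = G} {c = c} p = within G (λ q → q) (m≤n+m (size G) c) p

infixl 1 _>>=_
_>>=_ : Within c G P → (∀ {G′} → G ≼ G′ → P G′ → Within d G′ Q) → Within (c + d) G Q
_>>=_ {c = c} {G = G} {d = d} (within G₁ e₁ s₁ p₁) f with f e₁ p₁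
... | within G₂ e₂ s₂ p₂ = within G₂ (λ q → e₂ (e₁ q)) bnd p₂
  where
  open ≤-Reasoning
  bnd : size G₂ ≤ c + d + size G
  bnd = begin
    size G₂           ≤⟨ s₂ ⟩
    d + size G₁       ≤⟨ +-monoʳ-≤ d s₁ ⟩
    d + (c + size G)  ≡⟨ +-assoc d c _ ⟨
    d + c + size G    ≡⟨ cong (_+ size G) (+-comm d c) ⟩
    c + d + size G    ∎

mapWithin : (∀ {G′} → G ≼ G′ → P G′ → Q G′) → Within c G P → Within c G Q
mapWithin f (within G′ e s p) = within G′ e s (f e p)

relax : c ≤ d → Within c G P → Within d G P
relax {G = G} c≤d (within G′ e s p) = within G′ e (≤-trans s (+-monoˡ-≤ (size G) c≤d)) p

addRule : (G : Grammar A) (r : Rule A) → (∀ {Y Z} → r ≡ pair Y Z → Y < size G × Z < size G) →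
  Within 1 G (λ G′ → rules G′ ! size G ≡ r)
addRule G r ok = within (grammar (rules G ∷ʳ r) acyc) !-++ˡ bnd (!-last (rules G))
  where
  acyc : Acyclic (rules G ∷ʳ r)
  acyc k Y Z p with !-∷ʳ⁻ (rules G) p
  ... | inj₁ q          = acyclic G k Y Z q
  ... | inj₂ (refl , q) = ok q
  bnd : length (rules G ∷ʳ r) ≤ 1 + size G
  bnd = ≤-reflexive (trans (length-++ (rules G)) (+-comm _ 1))

-- Derivation trees of bounded height

-- `leaf` is available at every `h`, so the index bounds the height from above and does not fix it.
data ExpandsIn {A : Set} (G : Grammar A) : ℕ → ℕ → List A → Set where
  leaf : ∀ {h X a} → rules G ! X ≡ term a → ExpandsIn G h X (a ∷ [])
  node : ∀ {h X Y Z u v} → rules G ! X ≡ pair Y Z →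
         ExpandsIn G h Y u → ExpandsIn G h Z v → ExpandsIn G (suc h) X (u ++ v)

-- The empty word has no nonterminal, but may occur as a piece of a cut.
data Derives {A : Set} (G : Grammar A) (h : ℕ) : List A → Set where
  empty : Derives G h []
  by    : ∀ {X w} → ExpandsIn G h X w → Derives G h w

ExpandsIn-≼ : ∀ {X} → G ≼ G′ → ExpandsIn G h X w → ExpandsIn G′ h X w
ExpandsIn-≼ e (leaf p)     = leaf (e p)
ExpandsIn-≼ e (node p s t) = node (e p) (ExpandsIn-≼ e s) (ExpandsIn-≼ e t)

ExpandsIn-≤ : ∀ {X} → h ≤ h′ → ExpandsIn G h X w → ExpandsIn G h′ X w
ExpandsIn-≤ _         (leaf p)     = leaf p
ExpandsIn-≤ (s≤s h≤h′) (node p s t) = node p (ExpandsIn-≤ h≤h′ s) (ExpandsIn-≤ h≤h′ t)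

Derives-≼ : G ≼ G′ → Derives G h w → Derives G′ h w
Derives-≼ e empty  = empty
Derives-≼ e (by s) = by (ExpandsIn-≼ e s)

Derives-≤ : h ≤ h′ → Derives G h w → Derives G h′ w
Derives-≤ _    empty  = empty
Derives-≤ h≤h′ (by s) = by (ExpandsIn-≤ h≤h′ s)

ExpandsIn⇒< : ∀ {X} → ExpandsIn G h X w → X < size G
ExpandsIn⇒< (leaf p)     = !⇒< p
ExpandsIn⇒< (node p _ _) = !⇒< p

ExpandsIn⇒Expands : ∀ {X} → ExpandsIn G h X w → Expands (rules G) X w
ExpandsIn⇒Expands (leaf p)     = exp-term p
ExpandsIn⇒Expands (node p s t) = exp-pair p (ExpandsIn⇒Expands s) (ExpandsIn⇒Expands t)

concatenate : Derives G h u → Derives G h v → Within 1 G (λ G′ → Derives G′ (suc h) (u ++ v))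
concatenate {h = h} empty t = pure (Derives-≤ (n≤1+n h) t)
concatenate {G = G} {h = h} {u = u} s@(by _) empty =
  pure (subst (Derives G (suc h)) (sym (++-identityʳ u)) (Derives-≤ (n≤1+n h) s))
concatenate {G = G} (by {X = Y} s) (by {X = Z} t) =
  mapWithin (λ e p → by (node p (ExpandsIn-≼ e s) (ExpandsIn-≼ e t)))
    (addRule G (pair Y Z) λ { refl → ExpandsIn⇒< s , ExpandsIn⇒< t })

letter : (u : List A) → length u ≤ 1 → Within 1 G (λ G′ → Derives G′ 0 u)
letter []          _            = pure empty
letter {G = G} (a ∷ []) _       = mapWithin (λ _ p → by (leaf p)) (addRule G (term a) λ ())
letter (_ ∷ _ ∷ _) (s≤s ())

-- Cutting a derivation tree

-- Follow the cut down one path. Where it enters the right child, one rule joins the intact left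
-- subtree to the prefix cut from the right one. Both fit under the children's height bound, so the
-- height does not grow.
derivePrefix : ∀ {X} x → ExpandsIn G h X w → w ≡ x ++ y → Within h G (λ G′ → Derives G′ h x)
derivePrefix []          (leaf p)     eq   = pure empty
derivePrefix (a ∷ [])    (leaf p)     refl = pure (by (leaf p))
derivePrefix (_ ∷ _ ∷ _) (leaf p)     ()
derivePrefix {h = suc h} x (node {u = u} p s t) eq with levi u x eq
... | inj₁ (z , refl , eq′) = relax (≤-reflexive (+-comm h 1))
        (derivePrefix z t eq′ >>= λ e d → concatenate (Derives-≼ e (by s)) d)
... | inj₂ (z , eq′ , _)    =
        relax (n≤1+n h) (mapWithin (λ _ → Derives-≤ (n≤1+n h)) (derivePrefix x s eq′))

deriveSuffix : ∀ {X} x → ExpandsIn G h X w → w ≡ x ++ y → Within h G (λ G′ → Derives G′ h y)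
deriveSuffix []          (leaf p)     refl = pure (by (leaf p))
deriveSuffix (a ∷ [])    (leaf p)     refl = pure empty
deriveSuffix (_ ∷ _ ∷ _) (leaf p)     ()
deriveSuffix {h = suc h} x (node {u = u} p s t) eq with levi u x eq
... | inj₁ (z , _ , eq′)    =
        relax (n≤1+n h) (mapWithin (λ _ → Derives-≤ (n≤1+n h)) (deriveSuffix z t eq′))
... | inj₂ (z , eq′ , refl) = relax (≤-reflexive (+-comm h 1))
        (deriveSuffix x s eq′ >>= λ e d → concatenate d (Derives-≼ e (by t)))

-- Descend without new rules to the node where `w` straddles both children. There a suffix of the
-- left, a prefix of the right and one joining rule suffice: `h + (h + 1)` rules under the bound
-- `suc h`.
deriveInfix : ∀ {X} x → ExpandsIn G h X v → v ≡ x ++ w ++ y → Within (2 * h) G (λ G′ → Derives G′ h w)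
deriveInfix {w = []}    x s eq = pure empty
deriveInfix {w = a ∷ []} []       (leaf p) refl = pure (by (leaf p))
deriveInfix {w = _ ∷ _ ∷ _} []    (leaf p) ()
deriveInfix {w = _ ∷ _} (_ ∷ [])    (leaf p) ()
deriveInfix {w = _ ∷ _} (_ ∷ _ ∷ _) (leaf p) ()
deriveInfix {h = suc h} {w = w@(_ ∷ _)} x (node {u = u} p s t) eq with levi u x eq
... | inj₁ (z , refl , eq′) = relax (*-monoʳ-≤ 2 (n≤1+n h))
        (mapWithin (λ _ → Derives-≤ (n≤1+n h)) (deriveInfix z t eq′))
... | inj₂ (z , equ , eqz) with levi w z eqz
...   | inj₁ (z′ , refl , _) = relax (*-monoʳ-≤ 2 (n≤1+n h))
        (mapWithin (λ _ → Derives-≤ (n≤1+n h)) (deriveInfix x s equ))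
...   | inj₂ (z′ , w≡ , eqv) = relax cost
        (deriveSuffix x s equ >>= λ e d →
          derivePrefix z′ (ExpandsIn-≼ e t) eqv >>= λ e′ d′ →
          mapWithin (λ {G″} _ → subst (Derives G″ (suc h)) (sym w≡)) (concatenate (Derives-≼ e′ d) d′))
  where
  cost : h + (h + 1) ≤ 2 * suc h
  cost = ≤-trans (n≤1+n _) (≤-reflexive (lemma h))
    where
    lemma : ∀ h → suc (h + (h + 1)) ≡ 2 * suc h
    lemma = solve-∀

deriveFactor : Derives G h v → Factor w v → Within (2 * h) G (λ G′ → Derives G′ h w)
deriveFactor {w = []} empty _              = pure empty
deriveFactor {w = _ ∷ _} empty ([] , _ , ())
deriveFactor {w = _ ∷ _} empty (_ ∷ _ , _ , ())
deriveFactor (by s) (x , _ , eq)           = deriveInfix x s eq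

-- `derive` must work over every extension, because the rules of earlier items are already present
-- when an item is reached.
deriveAll : ∀ {I : Set} (f : I → List A) →
  (∀ i {G′} → G ≼ G′ → Within c G′ (λ G″ → Derives G″ h (f i))) →
  ∀ is → Within (length is * c) G (λ G′ → All (λ i → Derives G′ h (f i)) is)
deriveAll f derive []       = pure []
deriveAll f derive (i ∷ is) =
  derive i (λ p → p) >>= λ e d →
  mapWithin (λ e′ ds → Derives-≼ e′ d ∷ ds) (deriveAll f (λ j e′ → derive j (λ p → e′ (e p))) is)

-- Coverings of the short factors

-- Short factors need only lie inside derived words, so one word per attractor position can serve
-- many of them at once.
Covers : List A → Grammar A → ℕ → ℕ → Set
Covers T G h m = ∀ w → Factor w T → length w ≤ m → ∃ λ v → Derives G h v × Factor w v

Covers-≼ : ∀ {T : List A} → G ≼ G′ → Covers T G h m → Covers T G′ h m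
Covers-≼ e cov w f l with cov w f l
... | v , d , f′ = v , Derives-≼ e d , f′

-- Each piece of length at most `m` takes `2 * h` rules to cut out and one to attach. The
-- right-nested chain adds `b` to the height; `b` is 4 when doubling, and after the final assembly
-- the height no longer matters.
deriveLong : ∀ {T : List A} b → Covers T G h m → ∀ u → Factor u T → length u ≤ b * m →
  Within (b * suc (2 * h)) G (λ G′ → Derives G′ (b + h) u)
deriveLong         zero    cov []      f l = pure empty
deriveLong {G = G} {h = h} {m = m} (suc b) cov u f l with
  cov (take m u) (Factor-trans (take-Factor m u) f) (length-take-≤ m u)
... | v , d , f′ = relax (≤-reflexive cost)
  (deriveFactor d f′ >>= λ e d₁ →
   deriveLong b (Covers-≼ e cov) (drop m u) (Factor-trans (drop-Factor m u) f) rest >>= λ e′ d₂ →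
   mapWithin (λ {G″} _ → subst (Derives G″ (suc b + h)) (take++drop≡id m u))
     (concatenate (Derives-≤ (m≤n+m h b) (Derives-≼ e′ d₁)) d₂))
  where
  rest : length (drop m u) ≤ b * m
  rest = ≤-trans (≤-reflexive (length-drop m u)) (m≤n+o⇒m∸n≤o (length u) m l)
  cost : 2 * h + (b * suc (2 * h) + 1) ≡ suc b * suc (2 * h)
  cost = lemma h b
    where
    lemma : ∀ h b → 2 * h + (b * suc (2 * h) + 1) ≡ suc b * suc (2 * h)
    lemma = solve-∀

-- Attractor positions and windows

crossing : ∀ {T : List A} {Γ} → IsAttractor T Γ → ∀ w → 0 < length w → Factor w T →
  ∃₂ λ i p → p ∈ Γ × i ≤ p × p < i + length w × w ≡ take (length w) (drop i T)
crossing {T = T} att w@(a ∷ w′) _ (x , y , refl)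
  with att (length x) (length x + length w′) (m≤m+n _ _) j<n
  where
  j<n : length x + length w′ < length (x ++ w ++ y)
  j<n = begin-strict
    length x + length w′             <⟨ +-monoʳ-< (length x) (n<1+n _) ⟩
    length x + length w              ≤⟨ +-monoʳ-≤ (length x) (m≤m+n _ _) ⟩
    length x + (length w + length y) ≡⟨ cong (length x +_) (length-++ w) ⟨
    length x + length (w ++ y)       ≡⟨ length-++ x ⟨
    length (x ++ w ++ y)             ∎
    where open ≤-Reasoning
... | i′ , j′ , i′≤j′ , j′<n , eq , p , p∈Γ , i′≤p , p≤j′ =
  i′ , p , p∈Γ , i′≤p ,
  subst (p <_) (trans (sym (m+[n∸m]≡n (m≤n⇒m≤1+n i′≤j′))) (cong (i′ +_) len)) (s≤s p≤j′) ,
  trans (sym occ) (cong (λ k → take k (drop i′ T)) len)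
  where
  occ : substr T i′ j′ ≡ w
  occ = trans eq (trans (cong (λ k → take k (drop (length x) T)) width) (take-drop-++ x w y))
    where
    width : suc (length x + length w′) ∸ length x ≡ length w
    width = trans (cong (_∸ length x) (sym (+-suc (length x) (length w′)))) (m+n∸m≡n (length x) _)
  -- Since `j′ < length T`, `take` is not clipped at the end of `T`, so the interval is exactly as
  -- long as `w`.
  len : suc j′ ∸ i′ ≡ length w
  len = begin
    suc j′ ∸ i′                        ≡⟨ m≤n⇒m⊓n≡m (∸-monoˡ-≤ i′ j′<n) ⟨
    (suc j′ ∸ i′) ⊓ (length T ∸ i′)    ≡⟨ cong ((suc j′ ∸ i′) ⊓_) (length-drop i′ T) ⟨
    (suc j′ ∸ i′) ⊓ length (drop i′ T) ≡⟨ length-take (suc j′ ∸ i′) _ ⟨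
    length (substr T i′ j′)            ≡⟨ cong length occ ⟩
    length w                           ∎
    where open ≡-Reasoning

-- The truncated subtraction clips the window at the left end of T.
window : List A → ℕ → ℕ → List A
window T r p = take (r + r) (drop (suc p ∸ r) T)

-- A factor of length at most `r` through `p` starts at `p + 1 - r` or later and ends before
-- `p + r`. If the subtraction truncates to 0, the left condition is trivial and the window only
-- reaches further right.
crossing-window : ∀ {T : List A} {i p r} → i ≤ p → p < i + k → k ≤ r →
  Factor (take k (drop i T)) (window T r p)
crossing-window {k = k} {T = T} {i} {p} {r} i≤p p<i+k k≤r = window-Factor T
  (m≤n+o⇒m∸n≤o (suc p) r (≤-trans p<i+k (≤-trans (+-monoʳ-≤ i k≤r) (≤-reflexive (+-comm i r)))))
  (begin
    i + k                  ≤⟨ +-mono-≤ (m≤n⇒m≤1+n i≤p) k≤r ⟩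
    suc p + r              ≤⟨ +-monoˡ-≤ r (m≤n+m∸n (suc p) r) ⟩
    r + (suc p ∸ r) + r    ≡⟨ cong (_+ r) (+-comm r _) ⟩
    (suc p ∸ r) + r + r    ≡⟨ +-assoc (suc p ∸ r) r r ⟩
    (suc p ∸ r) + (r + r)  ∎)
  where open ≤-Reasoning

-- Cost arithmetic

extraction-cost : ∀ k → suc (2 * (4 * k)) ≤ 8 * suc k
extraction-cost k = begin
  suc (2 * (4 * k))  ≡⟨ cong suc (*-assoc 2 4 k) ⟨
  1 + 8 * k          ≤⟨ +-monoˡ-≤ (8 * k) {1} {8} (s≤s z≤n) ⟩
  8 + 8 * k          ≡⟨ *-suc 8 k ⟨
  8 * suc k          ∎
  where open ≤-Reasoning

-- Consecutive squares differ by more than `2 * l`, so costs linear in the level telescope to a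
-- quadratic total.
square-suc : ∀ c l → c * 2 * l + c * (l * l) ≤ c * (suc l * suc l)
square-suc c l = ≤-trans (m≤m+n _ c) (≤-reflexive (lemma c l))
  where
  lemma : ∀ c l → c * 2 * l + c * (l * l) + c ≡ c * (suc l * suc l)
  lemma = solve-∀

level-size : ∀ γ k {s s′} → s ≤ γ * (16 * (suc k * suc k)) →
  s′ ≤ γ * (4 * suc (2 * (4 * k))) + s → s′ ≤ γ * (16 * (suc (suc k) * suc (suc k)))
level-size γ k {s} {s′} s≤ s′≤ = begin
  s′                                                    ≤⟨ s′≤ ⟩
  γ * (4 * suc (2 * (4 * k))) + s                       ≤⟨ +-mono-≤ (*-monoʳ-≤ γ step) s≤ ⟩
  γ * (16 * 2 * suc k) + γ * (16 * (suc k * suc k))     ≡⟨ *-distribˡ-+ γ _ _ ⟨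
  γ * (16 * 2 * suc k + 16 * (suc k * suc k))           ≤⟨ *-monoʳ-≤ γ (square-suc 16 (suc k)) ⟩
  γ * (16 * (suc (suc k) * suc (suc k)))                ∎
  where
  open ≤-Reasoning
  step : 4 * suc (2 * (4 * k)) ≤ 16 * 2 * suc k
  step = ≤-trans (*-monoʳ-≤ 4 (extraction-cost k)) (≤-reflexive (sym (*-assoc 4 8 (suc k))))

-- Coverings from an attractor

module _ {T : List A} {Γ : List ℕ} (att : IsAttractor T Γ) where

  -- An occurrence of length one that meets `Γ` is itself an attractor position, so the letters at
  -- `Γ` are all the letters of `T`.
  cover-letters : Within (length Γ * 1) (grammar [] λ _ _ _ ()) (λ G → Covers T G 0 1)
  cover-letters = mapWithin (λ _ → covers) (deriveAll at (λ p _ → letter (at p) (length-take-≤ 1 (drop p T))) Γ)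
    where
    at : ℕ → List A
    at p = take 1 (drop p T)
    covers : All (λ p → Derives G 0 (at p)) Γ → Covers T G 0 1
    covers ds []          _ _        = [] , empty , Factor-refl
    covers ds (_ ∷ _ ∷ _) _ (s≤s ())
    covers ds w@(_ ∷ [])  f _ with crossing att w (s≤s z≤n) f
    ... | i , p , p∈Γ , i≤p , p<i+1 , eq
      with ≤-antisym i≤p (m<1+n⇒m≤n (subst (p <_) (+-comm i 1) p<i+1))
    ... | refl = at p , All.lookup ds p∈Γ , subst (λ z → Factor z (at p)) (sym eq) Factor-refl

  -- A factor far from `Γ` is replaced by an equal one crossing some `p`. Radius `2 * m` gives
  -- windows of length at most `4 * m`, hence four pieces.
  cover-double : Covers T G h m → Within (length Γ * (4 * suc (2 * h))) G (λ G′ → Covers T G′ (4 + h) (2 * m))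
  cover-double {G = G} {h = h} {m = m} cov = mapWithin (λ _ → covers)
    (deriveAll win (λ p e → deriveLong 4 (Covers-≼ e cov) (win p) (winT p) (short p)) Γ)
    where
    win : ℕ → List A
    win = window T (2 * m)
    winT : ∀ p → Factor (win p) T
    winT p = Factor-trans (take-Factor (2 * m + 2 * m) _) (drop-Factor (suc p ∸ 2 * m) T)
    short : ∀ p → length (win p) ≤ 4 * m
    short p = ≤-trans (length-take-≤ (2 * m + 2 * m) _) (≤-reflexive (sym (*-distribʳ-+ m 2 2)))
    covers : ∀ {G′} → All (λ p → Derives G′ (4 + h) (win p)) Γ → Covers T G′ (4 + h) (2 * m)
    covers ds []         _ _ = [] , empty , Factor-refl
    covers ds w@(_ ∷ _)  f l with crossing att w (s≤s z≤n) f
    ... | i , p , p∈Γ , i≤p , p<i+k , eq =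
      win p , All.lookup ds p∈Γ ,
      subst (λ z → Factor z (win p)) (sym eq) (crossing-window {T = T} i≤p p<i+k l)

  -- Cutting never raises the height, so each doubling adds only 4 to it; this keeps the cost of a
  -- level linear in `k`.
  cover-powers : ∀ k → ∃ λ G → size G ≤ length Γ * (16 * (suc k * suc k)) × Covers T G (4 * k) (2 ^ k)
  cover-powers zero with cover-letters
  ... | within G _ s cov =
    G , ≤-trans s (≤-trans (≤-reflexive (+-identityʳ _)) (*-monoʳ-≤ (length Γ) (s≤s z≤n))) , cov
  cover-powers (suc k) =
    let G , s , cov = cover-powers k
        within G′ _ s′ cov′ = cover-double cov
    in G′ , level-size (length Γ) k s s′ , subst (λ h → Covers T G′ h (2 ^ suc k)) (sym (*-suc 4 k)) cov′

-- Number of levels and final assembly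

n<2^[1+⌊log₂n⌋] : ∀ n → n < 2 ^ suc ⌊log₂ n ⌋
n<2^[1+⌊log₂n⌋] n = ≰⇒> λ le →
  1+n≰n (subst (_≤ ⌊log₂ n ⌋) (⌊log₂[2^n]⌋≡n (suc ⌊log₂ n ⌋)) (⌊log₂⌋-mono-≤ le))

-- Rounding `n / γ` up by one still stays within the next power of two. Hence `2 * γ` pieces of
-- length `2 ^ K` reach across `T`.
n≤γ*2^[1+⌊log₂ratio⌋] : ∀ n γ → 0 < γ → n ≤ γ * 2 ^ suc ⌊log₂ ratio n γ ⌋
n≤γ*2^[1+⌊log₂ratio⌋] n γ@(suc _) _ = begin
  n                              ≡⟨ m≡m%n+[m/n]*n n γ ⟩
  n % γ + n / γ * γ              ≤⟨ +-monoˡ-≤ _ (<⇒≤ (m%n<n n γ)) ⟩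
  suc (n / γ) * γ                ≤⟨ *-monoˡ-≤ γ (n<2^[1+⌊log₂n⌋] (n / γ)) ⟩
  2 ^ suc ⌊log₂ n / γ ⌋ * γ      ≡⟨ *-comm _ γ ⟩
  γ * 2 ^ suc ⌊log₂ n / γ ⌋      ∎
  where open ≤-Reasoning

attractor-nonempty : ∀ {T : List A} {Γ} → 0 < length T → IsAttractor T Γ → 0 < length Γ
attractor-nonempty {T = T} 0<n att with crossing att T 0<n Factor-refl
... | _ , _ , here _ , _                = s≤s z≤n
... | _ , _ , there _ , _ = s≤s z≤n

theorem3p14 : Σ ℕ λ C →
    (A : Set) → DecidableEquality A →
    (T : List A) → 0 < length T →
    (Γ : List ℕ) → IsPositionSet T Γ → IsAttractor T Γ →
    Σ (SLP A) λ G → GeneratesSLP G T ×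
    length G ≤ C * bound (length T) (length Γ)
theorem3p14 = 32 , λ A _ T 0<n Γ _ att → main T 0<n Γ att
  where
  main : ∀ {A : Set} (T : List A) → 0 < length T → ∀ Γ → IsAttractor T Γ →
    Σ (SLP A) λ G → GeneratesSLP G T × length G ≤ 32 * bound (length T) (length Γ)
  main T 0<n Γ att with cover-powers att ⌊log₂ ratio (length T) (length Γ) ⌋
  ... | G , s , cov with deriveLong (length Γ * 2) cov T Factor-refl
          (≤-trans (n≤γ*2^[1+⌊log₂ratio⌋] (length T) (length Γ) (attractor-nonempty 0<n att))
                   (≤-reflexive (sym (*-assoc (length Γ) 2 _))))
  -- A nonempty `T` rules out `empty`, so there is a root nonterminal `S` to start from.
  main (_ ∷ _) _ Γ _ | G , s , _ | within G′ _ s′ (by {X = S} d) =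
    rules G′ , (acyclic G′ , S , ExpandsIn⇒< d , ExpandsIn⇒Expands d) , bnd
    where
    γ = length Γ
    K = ⌊log₂ ratio _ γ ⌋
    open ≤-Reasoning
    bnd : size G′ ≤ 32 * (γ * (suc K * suc K))
    bnd = begin
      size G′                                                  ≤⟨ s′ ⟩
      γ * 2 * suc (2 * (4 * K)) + size G                       ≤⟨ +-mono-≤ (*-monoʳ-≤ (γ * 2) cost) s ⟩
      -- The constant 32 is 2 · 8 for the final assembly plus 16 for the coverings.
      γ * 2 * (8 * (suc K * suc K)) + γ * (16 * (suc K * suc K)) ≡⟨ lemma γ 8 (suc K * suc K) ⟩
      32 * (γ * (suc K * suc K))                               ∎
      where
      cost : suc (2 * (4 * K)) ≤ 8 * (suc K * suc K)
      cost = ≤-trans (extraction-cost K) (*-monoʳ-≤ 8 (m≤m*n (suc K) (suc K)))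
      lemma : ∀ γ c q → γ * 2 * (c * q) + γ * (2 * c * q) ≡ 2 * (2 * c) * (γ * q)
      lemma = solve-∀
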